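{- Let $N\ge9$, $\alpha\in\{2,3,4\}$ with $\alpha\mid N$, and $M_\alpha=N/\alpha$. Let $g$ be a $2\times5$ matrix over $\mathbb{Z}_N$ generating an admissible linear code, with columns indexed by $i=0,\dots,4$ and $\gcd_i=\gcd(g_{1i},g_{2i},N)$. Suppose exactly two columns of $g$ have $\gcd_i=M_\alpha$ and the other columns have $\gcd_i<M_\alpha$. Then $g$ cannot generate a thin non-degenerate linear code.
   Context: $\mathbb{Z}_N=\mathbb{Z}/N\mathbb{Z}$; its elements are identified with the representatives $0,1,\dots,N-1$, and gcd's are taken of these integers. The code generated by $g$ is the submodule of $\mathbb{Z}_N^5$ generated by the rows of $g$. A linear code is extended if every word has coordinate sum $0\bmod N$; call it admissible if it is extended and the greatest common divisor of $N$ and all entries of all words (equivalently of $N$ and all entries of $g$) is $1$. It is degenerate if some coordinate is zero in all words. An extended code is thin if it contains no word all of whose entries are nonzero. -}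

module Defs where

open import Data.Fin.Base using (Fin; toℕ)
open import Data.Fin.Patterns using (0F; 1F)
open import Data.Nat.Base using (ℕ; NonZero; _*_)
open import Data.Nat.DivMod using (_mod_)
open import Data.Nat.Divisibility using (_∣_)
open import Data.Nat.GCD using (gcd)
open import Data.Nat.Properties using (+-0-monoid)
open import Data.Product.Base using (∃-syntax; _×_)
open import Data.Sum.Base using (_⊎_)
open import Data.Vec.Functional using (Vector)
open import Level using (0ℓ)
open import Relation.Binary.PropositionalEquality.Core using (_≡_; _≢_)
open import Relation.Nullary.Negation.Core using (¬_)
open import Relation.Unary using (Pred; _∈_)

open import Algebra.Properties.Monoid.Sum +-0-monoid using (sum)

-- ℤ/Nℤ is Fin N: each residue class is its representative in {0, …, N-1}.

Word : ℕ → ℕ → Set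
Word N n = Vector (Fin N) n

Matrix : ℕ → ℕ → ℕ → Set
Matrix N m n = Vector (Word N n) m

Code : ℕ → ℕ → Set₁
Code N n = Pred (Word N n) 0ℓ

-- The sum is formed in ℕ on representatives and reduced mod N once, which
-- agrees with computing in ℤ/Nℤ.
combination : ∀ {N m n} .{{_ : NonZero N}} → Vector (Fin N) m → Matrix N m n → Word N n
combination {N} c g j = sum (λ i → toℕ (c i) * toℕ (g i j)) mod N

-- The submodule generated by the rows of g.  Words are functions, so they are
-- compared pointwise.
generatedBy : ∀ {N m n} .{{_ : NonZero N}} → Matrix N m n → Code N n
generatedBy {N} {m} g w = ∃[ c ] (∀ j → w j ≡ combination {m = m} c g j)

Extended : ∀ {N n} → Code N n → Set
Extended {N} C = ∀ w → w ∈ C → N ∣ sum (λ j → toℕ (w j))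

record IsGCDOf (P : Pred ℕ 0ℓ) (d : ℕ) : Set where
  field
    commonDivisor : ∀ {x} → x ∈ P → d ∣ x
    greatest      : ∀ {e} → (∀ {x} → x ∈ P → e ∣ x) → e ∣ d

ModulusOrEntry : ∀ {N n} → Code N n → Pred ℕ 0ℓ
ModulusOrEntry {N} C x = x ≡ N ⊎ (∃[ w ] w ∈ C × ∃[ j ] x ≡ toℕ (w j))

Admissible : ∀ {N n} → Code N n → Set
Admissible C = Extended C × IsGCDOf (ModulusOrEntry C) 1

Degenerate : ∀ {N n} → Code N n → Set
Degenerate C = ∃[ j ] (∀ w → w ∈ C → toℕ (w j) ≡ 0)

Thin : ∀ {N n} → Code N n → Set
Thin C = Extended C × ¬ (∃[ w ] w ∈ C × (∀ j → toℕ (w j) ≢ 0))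

columnGcd : ∀ {N n} → Matrix N 2 n → Fin n → ℕ
columnGcd {N} g i = gcd (gcd (toℕ (g 0F i)) (toℕ (g 1F i))) N

{-# OPTIONS --safe #-}
-- View the columns as linear forms on pairs of integers with values modulo N: p
-- and q those of order α, and r 0, r 1, r 2 the other three.  A thin code is a
-- covering of the pairs by the five kernels.  Since N ≥ 9 the kernels of the
-- forms α r k do not all have index 2, so some y avoids the three of them.  Call
-- x good if p x ≠ 0 ≠ q x.  Then the points x + t α y are all good, so each is
-- in the kernel of some r k, and the pattern of these t shows that 3 or 4
-- annihilates every r k x.  Call this number s.
--
-- If s is prime to α, then s x + α y is in none of the five kernels.  If s = α,
-- then y is a combination of good points, so α r k y = 0 against the choice of
-- y.  If α = 2 and s = 4, comparing x with x + 2 z gives 8 r k = 0, so N ∣ 8.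
module Submission where

open import Defs
open import Data.Nat.Base using (ℕ; NonZero; _≤_; _<_)
open import Data.Nat.Divisibility using (_∣_; quotient)
open import Data.Product.Base using (∃-syntax; _×_)
open import Data.Sum.Base using (_⊎_)
open import Relation.Binary.PropositionalEquality.Core using (_≡_; _≢_)
open import Relation.Nullary.Negation.Core using (¬_)

open import Algebra.Properties.CommutativeMonoid.Sum using (sum-remove)
open import Algebra.Properties.Monoid.Sum using (sum)
open import Data.Fin.Base using (Fin; toℕ; fromℕ<; punchIn; punchOut)
open import Data.Fin.Patterns using (0F; 1F; 2F; 3F)
open import Data.Fin.Properties
  using (_≟_; all?; any?; ¬∀⟶∃¬; toℕ-fromℕ<; punchIn-punchOut; punchInᵢ≢i; punchIn-injective)
open import Data.Integer.Base using (ℤ; +_; 0ℤ; 1ℤ; _+_; _-_; _*_; -_)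
open import Data.Integer.DivMod using (_%ℕ_; _/ℕ_; n%ℕd<d; a≡a%ℕn+[a/ℕn]*n)
import Data.Integer.Divisibility.Signed as ℤ∣
import Data.Integer.Properties as ℤₚ
open import Data.Integer.Tactic.RingSolver using (solve-∀)
import Data.Nat.Base as ℕ
import Data.Nat.DivMod as ℕ
import Data.Nat.Divisibility as ℕ
import Data.Nat.GCD as ℕ
import Data.Nat.Properties as ℕ
open import Data.Nat.Coprimality using (coprime-/gcd; coprime-divisor)
open import Data.Product.Base using (∃; _,_; proj₁; proj₂; curry)
open import Data.Sum.Base using (inj₁; inj₂; [_,_]′)
open import Data.Vec.Functional using (removeAt)
open import Function.Base using (_∘_; _$_; flip; id)
open import Relation.Binary.PropositionalEquality.Core
  using (refl; sym; trans; cong; cong₂; subst; subst₂)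
open import Relation.Binary.PropositionalEquality.Properties using (module ≡-Reasoning)
open import Relation.Nullary.Decidable using (Dec; yes; no; from-yes; ¬?; _→-dec_)
open import Relation.Nullary.Negation.Core using (contradiction)
open import Relation.Unary using (Pred; _∈_)

open ℤ∣ using () renaming (_∣_ to infix 4 _∣ℤ_; _∣?_ to infix 4 _∣ℤ?_)

infix 4 _∤ℤ_
_∤ℤ_ : ℤ → ℤ → Set
m ∤ℤ z = ¬ m ∣ℤ z

∣-combination : ∀ {n a b c} → n ∣ℤ a → n ∣ℤ b → ∀ u v → u * a + v * b ≡ c → n ∣ℤ c
∣-combination {n} n∣a n∣b u v eq =
  subst (n ∣ℤ_) eq (ℤ∣.∣m∣n⇒∣m+n (ℤ∣.∣n⇒∣m*n u n∣a) (ℤ∣.∣n⇒∣m*n v n∣b))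

even⊎odd : ∀ z → (∃[ k ] z ≡ + 2 * k) ⊎ (∃[ k ] z ≡ 1ℤ + + 2 * k)
even⊎odd z with z %ℕ 2 | n%ℕd<d z 2 | a≡a%ℕn+[a/ℕn]*n z 2
... | 0 | _ | eq = inj₁ (z /ℕ 2 , trans eq (lemma (z /ℕ 2)))
  where
  lemma : ∀ k → 0ℤ + k * + 2 ≡ + 2 * k
  lemma = solve-∀
... | 1 | _ | eq = inj₂ (z /ℕ 2 , trans eq (lemma (z /ℕ 2)))
  where
  lemma : ∀ k → 1ℤ + k * + 2 ≡ 1ℤ + + 2 * k
  lemma = solve-∀
... | ℕ.suc (ℕ.suc _) | ℕ.s≤s (ℕ.s≤s ()) | _

halve : ∀ {n a} k → + 2 * a ≡ + 2 * k * n → n ∣ℤ a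
halve {n} {a} k eq =
  ℤ∣.divides k (ℤₚ.*-cancelˡ-≡ (+ 2) a (k * n) (trans eq (ℤₚ.*-assoc (+ 2) k n)))

-- ℤ/nℤ has at most one element of order two.
involutions-cancel : ∀ {n a b} → n ∣ℤ + 2 * a → n ∣ℤ + 2 * b →
                     n ∤ℤ a → n ∤ℤ b → n ∣ℤ a + b
involutions-cancel {n} {a} {b} (ℤ∣.divides k 2a≡kn) (ℤ∣.divides l 2b≡ln) n∤a n∤b
  with even⊎odd k | even⊎odd l
... | inj₁ (k′ , refl) | _ = contradiction (halve k′ 2a≡kn) n∤a
... | inj₂ _ | inj₁ (l′ , refl) = contradiction (halve l′ 2b≡ln) n∤b
... | inj₂ (k′ , refl) | inj₂ (l′ , refl) = ℤ∣.divides (1ℤ + k′ + l′) $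
  ℤₚ.*-cancelˡ-≡ (+ 2) _ _ $
  trans (ℤₚ.*-distribˡ-+ (+ 2) a b) (trans (cong₂ _+_ 2a≡kn 2b≡ln) (lemma k′ l′ n))
  where
  lemma : ∀ k l n → (1ℤ + + 2 * k) * n + (1ℤ + + 2 * l) * n ≡ + 2 * ((1ℤ + k + l) * n)
  lemma = solve-∀

-- Along t ↦ c + t d, the zeros modulo n are at distance at least 3 when
-- n ∤ 2d and at distance at least 2 when n ∤ d; four consecutive values of t
-- are too many for two such sets.
avoid-progressions : ∀ {n} A B a b → n ∤ℤ + 2 * a → n ∤ℤ b →
                     ∃[ t ] (n ∤ℤ A + t * a × n ∤ℤ B + t * b)
avoid-progressions {n} A B a b n∤2a n∤b = search
  where
  2gap : ∀ c d t u → u ≡ t + + 2 → n ∣ℤ c + t * d → n ∣ℤ c + u * d → n ∣ℤ + 2 * d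
  2gap c d t _ refl p q = ∣-combination p q (- 1ℤ) 1ℤ (lemma c d t)
    where
    lemma : ∀ c d t → - 1ℤ * (c + t * d) + 1ℤ * (c + (t + + 2) * d) ≡ + 2 * d
    lemma = solve-∀
  1gap : ∀ c d t u → u ≡ t + 1ℤ → n ∣ℤ c + t * d → n ∣ℤ c + u * d → n ∣ℤ d
  1gap c d t _ refl p q = ∣-combination p q (- 1ℤ) 1ℤ (lemma c d t)
    where
    lemma : ∀ c d t → - 1ℤ * (c + t * d) + 1ℤ * (c + (t + 1ℤ) * d) ≡ d
    lemma = solve-∀
  n∤a : n ∤ℤ a
  n∤a = n∤2a ∘ ℤ∣.∣n⇒∣m*n (+ 2)
  search : ∃[ t ] (n ∤ℤ A + t * a × n ∤ℤ B + t * b)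
  search with n ∣ℤ? B + 1ℤ * b
  search | yes B₁ with n ∣ℤ? A + 0ℤ * a
  ... | no ¬A₀ = 0ℤ , ¬A₀ , λ B₀ → n∤b (1gap B b 0ℤ 1ℤ refl B₀ B₁)
  ... | yes A₀ = + 2 , (λ A₂ → n∤2a (2gap A a 0ℤ (+ 2) refl A₀ A₂))
                     , (λ B₂ → n∤b (1gap B b 1ℤ (+ 2) refl B₁ B₂))
  search | no ¬B₁ with n ∣ℤ? A + 1ℤ * a
  ... | no ¬A₁ = 1ℤ , ¬A₁ , ¬B₁
  ... | yes A₁ with n ∣ℤ? B + + 2 * b
  ...   | no ¬B₂ = + 2 , (λ A₂ → n∤a (1gap A a 1ℤ (+ 2) refl A₁ A₂)) , ¬B₂
  ...   | yes B₂ = + 3 , (λ A₃ → n∤2a (2gap A a 1ℤ (+ 3) refl A₁ A₃))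
                       , (λ B₃ → n∤b (1gap B b (+ 2) (+ 3) refl B₂ B₃))

remaining-unique : ∀ (i j k l : Fin 3) → i ≢ j → k ≢ i → k ≢ j → l ≢ i → l ≢ j → k ≡ l
remaining-unique = from-yes $ all? {n = 3} λ i → all? λ j → all? λ k → all? λ l →
  ¬? (i ≟ j) →-dec ¬? (k ≟ i) →-dec ¬? (k ≟ j) →-dec ¬? (l ≟ i) →-dec ¬? (l ≟ j) →-dec k ≟ l

complete-pair : ∀ (b : Fin 3 → ℤ) i j → i ≢ j →
                ∃[ k ] b i + b j + b k ≡ b 0F + b 1F + b 2F
complete-pair b 0F 0F i≢j = contradiction refl i≢j
complete-pair b 0F 1F _ = 2F , refl
complete-pair b 0F 2F _ = 1F , lemma (b 0F) (b 1F) (b 2F)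
  where
  lemma : ∀ x y z → x + z + y ≡ x + y + z
  lemma = solve-∀
complete-pair b 1F 0F _ = 2F , lemma (b 0F) (b 1F) (b 2F)
  where
  lemma : ∀ x y z → y + x + z ≡ x + y + z
  lemma = solve-∀
complete-pair b 1F 1F i≢j = contradiction refl i≢j
complete-pair b 1F 2F _ = 0F , lemma (b 0F) (b 1F) (b 2F)
  where
  lemma : ∀ x y z → y + z + x ≡ x + y + z
  lemma = solve-∀
complete-pair b 2F 0F _ = 1F , lemma (b 0F) (b 1F) (b 2F)
  where
  lemma : ∀ x y z → z + x + y ≡ x + y + z
  lemma = solve-∀
complete-pair b 2F 1F _ = 0F , lemma (b 0F) (b 1F) (b 2F)
  where
  lemma : ∀ x y z → z + y + x ≡ x + y + z
  lemma = solve-∀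
complete-pair b 2F 2F i≢j = contradiction refl i≢j

-- Colour t by some k with n ∣ a k + t b k.  Consecutive colours differ.  If
-- some colour recurs after two steps, it fills a parity class and the other two
-- colours alternate on the other class; otherwise the colouring has period 3.
module Colouring {n : ℤ} (a b : Fin 3 → ℤ)
  (n∤b : ∀ k → n ∤ℤ b k) (n∣∑b : n ∣ℤ b 0F + b 1F + b 2F)
  (covered : ∀ t → ∃[ k ] n ∣ℤ a k + t * b k) where

  colour : ℤ → Fin 3
  colour t = proj₁ (covered t)

  gap : ∀ {k} t d → n ∣ℤ a k + t * b k → n ∣ℤ a k + (t + d) * b k → n ∣ℤ d * b k
  gap {k} t d p q = ∣-combination p q (- 1ℤ) 1ℤ (lemma (a k) (b k) t d)
    where
    lemma : ∀ a b t d → - 1ℤ * (a + t * b) + 1ℤ * (a + (t + d) * b) ≡ d * b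
    lemma = solve-∀

  recurrence : ∀ t d → colour t ≡ colour (t + d) → n ∣ℤ d * b (colour t)
  recurrence t d eq = gap t d (proj₂ (covered t))
    (subst (λ k → n ∣ℤ a k + (t + d) * b k) (sym eq) (proj₂ (covered (t + d))))

  colour-step : ∀ t → colour t ≢ colour (t + 1ℤ)
  colour-step t eq = n∤b _ (subst (n ∣ℤ_) (ℤₚ.*-identityˡ _) (recurrence t 1ℤ eq))

  annihilates : ∀ {k} t s → n ∣ℤ a k + t * b k → n ∣ℤ s * b k → n ∣ℤ s * a k
  annihilates {k} t s p q = ∣-combination p q s (- t) (lemma (a k) (b k) t s)
    where
    lemma : ∀ a b t s → s * (a + t * b) + - t * (s * b) ≡ s * a
    lemma = solve-∀

  involution-unique : ∀ {i j} → i ≢ j → n ∣ℤ + 2 * b i → n ∤ℤ + 2 * b j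
  involution-unique {i} {j} i≢j 2bᵢ 2bⱼ with complete-pair b i j i≢j
  ... | k , ∑≡ = n∤b k $ ℤ∣.∣m+n∣m⇒∣n (subst (n ∣ℤ_) (sym ∑≡) n∣∑b)
                          (involutions-cancel 2bᵢ 2bⱼ (n∤b i) (n∤b j))

  period-2 : ∀ t → colour t ≡ colour (t + + 2) → ∀ k → n ∣ℤ + 4 * a k
  period-2 t eq k = by-cases (k ≟ i) (k ≟ colour (u 0ℤ))
    where
    i : Fin 3
    i = colour t
    2bᵢ : n ∣ℤ + 2 * b i
    2bᵢ = recurrence t (+ 2) eq
    u : ℤ → ℤ
    u m = t + (1ℤ + + 2 * m)
    avoids-i : ∀ m → colour (u m) ≢ i
    avoids-i m eq′ = n∤b i $
      ∣-combination (recurrence t (1ℤ + + 2 * m) (sym eq′)) 2bᵢ 1ℤ (- m) (lemma (b i) m)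
      where
      lemma : ∀ b m → 1ℤ * ((1ℤ + + 2 * m) * b) + - m * (+ 2 * b) ≡ b
      lemma = solve-∀
    u-shift : ∀ m d → u (m + d) ≡ u m + + 2 * d
    u-shift m d = lemma t m d
      where
      lemma : ∀ t m d → t + (1ℤ + + 2 * (m + d)) ≡ t + (1ℤ + + 2 * m) + + 2 * d
      lemma = solve-∀
    alternates : ∀ m → colour (u m) ≢ colour (u (m + 1ℤ))
    alternates m eq′ = involution-unique (avoids-i m ∘ sym) 2bᵢ
      (recurrence (u m) (+ 2) (trans eq′ (cong colour (u-shift m 1ℤ))))
    4b : ∀ m → n ∣ℤ + 4 * b (colour (u m))
    4b m = recurrence (u m) (+ 4) $ trans
      (remaining-unique i (colour (u (m + 1ℤ))) _ (colour (u (m + 1ℤ + 1ℤ)))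
        (avoids-i (m + 1ℤ) ∘ sym) (avoids-i m) (alternates m)
        (avoids-i (m + 1ℤ + 1ℤ)) (alternates (m + 1ℤ) ∘ sym))
      (cong colour (trans (cong u (ℤₚ.+-assoc m 1ℤ 1ℤ)) (u-shift m (+ 2))))
    4a : ∀ m → n ∣ℤ + 4 * a (colour (u m))
    4a m = annihilates (u m) (+ 4) (proj₂ (covered (u m))) (4b m)
    by-cases : Dec (k ≡ i) → Dec (k ≡ colour (u 0ℤ)) → n ∣ℤ + 4 * a k
    by-cases (yes refl) _ = annihilates t (+ 4) (proj₂ (covered t)) $
      subst (n ∣ℤ_) (sym (ℤₚ.*-assoc (+ 2) (+ 2) (b i))) (ℤ∣.∣n⇒∣m*n (+ 2) 2bᵢ)
    by-cases (no _) (yes refl) = 4a 0ℤ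
    by-cases (no k≢i) (no k≢j) = subst (λ l → n ∣ℤ + 4 * a l)
      (remaining-unique i (colour (u 0ℤ)) _ _ (avoids-i 0ℤ ∘ sym)
        (avoids-i 1ℤ) (alternates 0ℤ ∘ sym) k≢i k≢j)
      (4a 1ℤ)

  period-3 : (∀ (m : Fin 4) → colour (+ toℕ m) ≢ colour (+ toℕ m + + 2)) →
             ∀ k → n ∣ℤ + 3 * a k
  period-3 2-apart k = by-cases (k ≟ colour 0ℤ) (k ≟ colour 1ℤ)
    where
    3a : ∀ t → colour t ≢ colour (t + + 2) → colour (t + 1ℤ) ≢ colour (t + 1ℤ + + 2) →
         n ∣ℤ + 3 * a (colour t)
    3a t h h′ = annihilates t (+ 3) (proj₂ (covered t)) $ recurrence t (+ 3) $
      remaining-unique (colour (t + 1ℤ)) (colour (t + + 2)) _ _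
        (colour-step (t + 1ℤ) ∘ flip trans (cong colour (sym (ℤₚ.+-assoc t 1ℤ 1ℤ))))
        (colour-step t) h
        (h′ ∘ flip trans (cong colour (sym (ℤₚ.+-assoc t 1ℤ (+ 2)))) ∘ sym)
        (colour-step (t + + 2) ∘ flip trans (cong colour (sym (ℤₚ.+-assoc t (+ 2) 1ℤ))) ∘ sym)
    by-cases : Dec (k ≡ colour 0ℤ) → Dec (k ≡ colour 1ℤ) → n ∣ℤ + 3 * a k
    by-cases (yes refl) _ = 3a 0ℤ (2-apart 0F) (2-apart 1F)
    by-cases (no _) (yes refl) = 3a 1ℤ (2-apart 1F) (2-apart 2F)
    by-cases (no k≢0) (no k≢1) = subst (λ l → n ∣ℤ + 3 * a l)
      (remaining-unique (colour 0ℤ) (colour 1ℤ) _ _ (colour-step 0ℤ)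
        (2-apart 0F ∘ sym) (colour-step 1ℤ ∘ sym) k≢0 k≢1)
      (3a (+ 2) (2-apart 2F) (2-apart 3F))

  annihilator : (∀ k → n ∣ℤ + 3 * a k) ⊎ (∀ k → n ∣ℤ + 4 * a k)
  annihilator with any? {n = 4} (λ m → colour (+ toℕ m) ≟ colour (+ toℕ m + + 2))
  ... | yes (m , eq) = inj₂ (period-2 (+ toℕ m) eq)
  ... | no ¬∃ = inj₁ (period-3 (curry ¬∃))

module LinearForms (n : ℤ) {G : Set} (_⊕[_]_ : G → ℤ → G → G) where

  record Linear (f : G → ℤ) : Set where
    constructor mkLinear
    field
      expand : ∀ x t y → f (x ⊕[ t ] y) ≡ f x + t * f y

  open Linear

  Nonzero : Pred (G → ℤ) _
  Nonzero f = ∃[ x ] n ∤ℤ f x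

  scale : ∀ β {f} → Linear f → Linear (λ x → β * f x)
  scale β {f} linear .expand x t y =
    trans (cong (β *_) (expand linear x t y)) (lemma β (f x) t (f y))
    where
    lemma : ∀ β fx t fy → β * (fx + t * fy) ≡ β * fx + t * (β * fy)
    lemma = solve-∀

  avoid-two : ∀ {f g} → Linear f → Linear g → Nonzero f → Nonzero g →
              ∃[ x ] (n ∤ℤ f x × n ∤ℤ g x)
  avoid-two {f} {g} f-linear g-linear (x , fx≢0) (y , gy≢0) with n ∣ℤ? g x | n ∣ℤ? f y
  ... | no gx≢0  | _        = x , fx≢0 , gx≢0
  ... | yes _    | no fy≢0  = y , fy≢0 , gy≢0
  ... | yes gx≡0 | yes fy≡0 = x ⊕[ 1ℤ ] y
    , (λ z → fx≢0 (ℤ∣.∣m+n∣n⇒∣m (subst (n ∣ℤ_) (expand f-linear x 1ℤ y) z)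
                                (ℤ∣.∣n⇒∣m*n 1ℤ fy≡0)))
    , (λ z → gy≢0 (subst (n ∣ℤ_) (ℤₚ.*-identityˡ _)
                    (ℤ∣.∣m+n∣m⇒∣n (subst (n ∣ℤ_) (expand g-linear x 1ℤ y) z) gx≡0)))

  -- The factor 2 is needed: three subgroups of index 2 can cover G.
  avoid-three : ∀ {f g h} → Linear f → Linear g → Linear h →
                Nonzero (λ x → + 2 * f x) → Nonzero g → Nonzero h →
                ∃[ x ] (n ∤ℤ f x × n ∤ℤ g x × n ∤ℤ h x)
  avoid-three {f} {g} {h} f-linear g-linear h-linear 2f≢0 g≢0 (z , hz≢0)
    with avoid-two (scale (+ 2) f-linear) g-linear 2f≢0 g≢0
  ... | x , 2fx≢0 , gx≢0 with n ∣ℤ? h x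
  ...   | no hx≢0 = x , 2fx≢0 ∘ ℤ∣.∣n⇒∣m*n (+ 2) , gx≢0 , hx≢0
  ...   | yes hx≡0 with avoid-progressions (f z) (g z) (f x) (g x) 2fx≢0 gx≢0
  ...     | t , f≢0 , g≢0 = z ⊕[ t ] x
    , f≢0 ∘ subst (n ∣ℤ_) (expand f-linear z t x)
    , g≢0 ∘ subst (n ∣ℤ_) (expand g-linear z t x)
    , (λ h≡0 → hz≢0 (ℤ∣.∣m+n∣n⇒∣m (subst (n ∣ℤ_) (expand h-linear z t x) h≡0)
                                  (ℤ∣.∣n⇒∣m*n t hx≡0)))

  avoid-family : ∀ {f : Fin 3 → G → ℤ} → (∀ k → Linear (f k)) → (∀ k → Nonzero (f k)) →
                 (∃[ k ] Nonzero (λ x → + 2 * f k x)) → ∃[ x ] (∀ k → n ∤ℤ f k x)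
  avoid-family linear f≢0 (0F , 2f≢0)
    with avoid-three (linear 0F) (linear 1F) (linear 2F) 2f≢0 (f≢0 1F) (f≢0 2F)
  ... | x , ≢0 , ≢1 , ≢2 = x , λ { 0F → ≢0 ; 1F → ≢1 ; 2F → ≢2 }
  avoid-family linear f≢0 (1F , 2f≢0)
    with avoid-three (linear 1F) (linear 0F) (linear 2F) 2f≢0 (f≢0 0F) (f≢0 2F)
  ... | x , ≢1 , ≢0 , ≢2 = x , λ { 0F → ≢0 ; 1F → ≢1 ; 2F → ≢2 }
  avoid-family linear f≢0 (2F , 2f≢0)
    with avoid-three (linear 2F) (linear 0F) (linear 1F) 2f≢0 (f≢0 0F) (f≢0 1F)
  ... | x , ≢2 , ≢0 , ≢1 = x , λ { 0F → ≢0 ; 1F → ≢1 ; 2F → ≢2 }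

  module Covering
    {α : ℤ} {p q : G → ℤ} {r : Fin 3 → G → ℤ}
    (p-linear : Linear p) (q-linear : Linear q) (r-linear : ∀ k → Linear (r k))
    (αp≡0 : ∀ x → n ∣ℤ α * p x) (αq≡0 : ∀ x → n ∣ℤ α * q x)
    (∑r≡0 : ∀ x → n ∣ℤ α * r 0F x + α * r 1F x + α * r 2F x)
    (covered : ∀ x → n ∣ℤ p x ⊎ n ∣ℤ q x ⊎ ∃[ k ] n ∣ℤ r k x)
    (y : G) (αry≢0 : ∀ k → n ∤ℤ α * r k y) where

    Good : Pred G _
    Good x = n ∤ℤ p x × n ∤ℤ q x

    shift : G → ℤ → G → G
    shift x t z = x ⊕[ t * α ] z

    shift-value : ∀ {f} → Linear f → ∀ x t z → f (shift x t z) ≡ f x + t * (α * f z)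
    shift-value {f} linear x t z =
      trans (expand linear x (t * α) z) (cong (_+_ (f x)) (ℤₚ.*-assoc t α (f z)))

    shift-zero : ∀ {f} → Linear f → (∀ x → n ∣ℤ α * f x) →
                 ∀ x t z → n ∣ℤ f (shift x t z) → n ∣ℤ f x
    shift-zero linear αf≡0 x t z f≡0 =
      ℤ∣.∣m+n∣n⇒∣m (subst (n ∣ℤ_) (shift-value linear x t z) f≡0) (ℤ∣.∣n⇒∣m*n t (αf≡0 z))

    shift-good : ∀ x t z → Good x → Good (shift x t z)
    shift-good x t z (px≢0 , qx≢0) = px≢0 ∘ shift-zero p-linear αp≡0 x t z
                                   , qx≢0 ∘ shift-zero q-linear αq≡0 x t z

    good⇒r-zero : ∀ x → Good x → ∃[ k ] n ∣ℤ r k x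
    good⇒r-zero x (px≢0 , qx≢0) with covered x
    ... | inj₁ px≡0        = contradiction px≡0 px≢0
    ... | inj₂ (inj₁ qx≡0) = contradiction qx≡0 qx≢0
    ... | inj₂ (inj₂ zero) = zero

    3-or-4-annihilates : ∀ x → Good x → (∀ k → n ∣ℤ + 3 * r k x) ⊎ (∀ k → n ∣ℤ + 4 * r k x)
    3-or-4-annihilates x good =
      Colouring.annihilator (λ k → r k x) (λ k → α * r k y) αry≢0 (∑r≡0 y) λ t →
        let k , zero = good⇒r-zero (shift x t y) (shift-good x t y good)
        in k , subst (n ∣ℤ_) (shift-value (r-linear k) x t y) zero

    -- If s is a unit modulo α, then s x + α y lies in none of the five kernels.
    unit-cannot-annihilate : ∀ s u v → u * s + v * α ≡ 1ℤ →
                             ∀ x → Good x → ¬ (∀ k → n ∣ℤ s * r k x)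
    unit-cannot-annihilate s u v us+vα≡1 x (px≢0 , qx≢0) srx≡0 =
      let k , r≡0 = good⇒r-zero z (px≢0 ∘ nonzero p-linear αp≡0 , qx≢0 ∘ nonzero q-linear αq≡0)
      in αry≢0 k (subst (n ∣ℤ_) (ℤₚ.*-identityˡ _)
           (ℤ∣.∣m+n∣m⇒∣n (subst (n ∣ℤ_) (value (r-linear k)) r≡0) (srx≡0 k)))
      where
      sx z : G
      sx = x ⊕[ s - 1ℤ ] x
      z = shift sx 1ℤ y
      sx-value : ∀ {f} → Linear f → f sx ≡ s * f x
      sx-value {f} linear = trans (expand linear x (s - 1ℤ) x) (lemma s (f x))
        where
        lemma : ∀ s fx → fx + (s - 1ℤ) * fx ≡ s * fx
        lemma = solve-∀
      value : ∀ {f} → Linear f → f z ≡ s * f x + 1ℤ * (α * f y)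
      value linear = trans (shift-value linear sx 1ℤ y) (cong (_+ _) (sx-value linear))
      nonzero : ∀ {f} → Linear f → (∀ x → n ∣ℤ α * f x) → n ∣ℤ f z → n ∣ℤ f x
      nonzero {f} linear αf≡0 fz≡0 = ∣-combination sfx≡0 (αf≡0 x) u v $
        trans (lemma u s v α (f x)) (trans (cong (_* f x) us+vα≡1) (ℤₚ.*-identityˡ (f x)))
        where
        sfx≡0 : n ∣ℤ s * f x
        sfx≡0 = subst (n ∣ℤ_) (sx-value linear) (shift-zero linear αf≡0 sx 1ℤ y fz≡0)
        lemma : ∀ u s v α fx → u * (s * fx) + v * (α * fx) ≡ (u * s + v * α) * fx
        lemma = solve-∀

    -- If x and y + t x are good, α r k vanishes at both, hence at y.
    α-cannot-annihilate : Nonzero (λ x → + 2 * p x) → Nonzero q →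
                          ¬ (∀ x → Good x → ∀ k → n ∣ℤ α * r k x)
    α-cannot-annihilate 2p≢0 q≢0 αr≡0
      with avoid-two (scale (+ 2) p-linear) q-linear 2p≢0 q≢0
    ... | x , 2px≢0 , qx≢0 with avoid-progressions (p y) (q y) (p x) (q x) 2px≢0 qx≢0
    ...   | t , p≢0 , q≢0 = αry≢0 0F $ ℤ∣.∣m+n∣n⇒∣m
      (subst (n ∣ℤ_) (expand (scale α (r-linear 0F)) y t x)
        (αr≡0 (y ⊕[ t ] x) (p≢0 ∘ subst (n ∣ℤ_) (expand p-linear y t x)
                           , q≢0 ∘ subst (n ∣ℤ_) (expand q-linear y t x)) 0F))
      (ℤ∣.∣n⇒∣m*n t (αr≡0 x (2px≢0 ∘ ℤ∣.∣n⇒∣m*n (+ 2) , qx≢0) 0F))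

    annihilator-on-good⇒everywhere :
      ∀ s → ∃ Good → (∀ x → Good x → ∀ k → n ∣ℤ s * r k x) →
      ∀ k z → n ∣ℤ s * α * r k z
    annihilator-on-good⇒everywhere s (x , good) sr≡0 k z = subst (n ∣ℤ_) (lemma s α (r k z)) $
      ℤ∣.∣m+n∣m⇒∣n (subst (n ∣ℤ_) value (sr≡0 _ (shift-good x 1ℤ z good) k)) (sr≡0 x good k)
      where
      lemma : ∀ s α rz → s * (1ℤ * (α * rz)) ≡ s * α * rz
      lemma = solve-∀
      value : s * r k (shift x 1ℤ z) ≡ s * r k x + s * (1ℤ * (α * r k z))
      value = trans (cong (s *_) (shift-value (r-linear k) x 1ℤ z)) (ℤₚ.*-distribˡ-+ s _ _)

annihilated-coprime : ∀ {P : Pred ℕ _} N .{{_ : NonZero N}} m → IsGCDOf P 1 →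
                      (∀ {x} → x ∈ P → N ∣ m ℕ.* x) → N ∣ m
annihilated-coprime {P} N m gcd≡1 N∣mx =
  subst (_∣ m) d≡N (ℕ.gcd[m,n]∣n N m)
  where
  d : ℕ
  d = ℕ.gcd N m
  instance
    d≢0 : NonZero d
    d≢0 = ℕ.≢-nonZero (ℕ.gcd[m,n]≢0 N m (inj₁ (ℕ.≢-nonZero⁻¹ N)))
  h : ℕ
  h = N ℕ./ d
  h∣1 : h ∣ 1
  h∣1 = IsGCDOf.greatest gcd≡1 λ {x} x∈P → coprime-divisor (coprime-/gcd N m) $
    ℕ.*-cancelʳ-∣ d (subst₂ _∣_ (sym (ℕ.m/n*n≡m (ℕ.gcd[m,n]∣m N m))) (lemma x) (N∣mx x∈P))
    where
    open ℕ.≤-Reasoning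
    lemma : ∀ x → m ℕ.* x ≡ m ℕ./ d ℕ.* x ℕ.* d
    lemma x = begin-equality
      m ℕ.* x                   ≡⟨ cong (ℕ._* x) (ℕ.m/n*n≡m (ℕ.gcd[m,n]∣n N m)) ⟨
      m ℕ./ d ℕ.* d ℕ.* x       ≡⟨ ℕ.*-assoc (m ℕ./ d) d x ⟩
      m ℕ./ d ℕ.* (d ℕ.* x)     ≡⟨ cong (m ℕ./ d ℕ.*_) (ℕ.*-comm d x) ⟩
      m ℕ./ d ℕ.* (x ℕ.* d)     ≡⟨ ℕ.*-assoc (m ℕ./ d) x d ⟨
      m ℕ./ d ℕ.* x ℕ.* d       ∎
  d≡N : d ≡ N
  d≡N = begin-equality
    d              ≡⟨ ℕ.*-identityˡ d ⟨
    1 ℕ.* d        ≡⟨ cong (ℕ._* d) (ℕ.∣1⇒≡1 h∣1) ⟨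
    h ℕ.* d        ≡⟨ ℕ.m/n*n≡m (ℕ.gcd[m,n]∣m N m) ⟩
    N              ∎
    where open ℕ.≤-Reasoning

Point : Set
Point = ℤ × ℤ

_⊕[_]_ : Point → ℤ → Point → Point
(x₁ , x₂) ⊕[ t ] (y₁ , y₂) = x₁ + t * y₁ , x₂ + t * y₂

module Columns (N : ℕ) .{{_ : NonZero N}} {m : ℕ} (g : Matrix N 2 m) where

  n : ℤ
  n = + N

  open LinearForms n _⊕[_]_ public
  open Linear public

  form : Fin m → Point → ℤ
  form j (x₁ , x₂) = x₁ * + toℕ (g 0F j) + x₂ * + toℕ (g 1F j)

  form-linear : ∀ j → Linear (form j)
  form-linear j .expand (x₁ , x₂) t (y₁ , y₂) =
    lemma (+ toℕ (g 0F j)) (+ toℕ (g 1F j)) x₁ x₂ t y₁ y₂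
    where
    lemma : ∀ a b x₁ x₂ t y₁ y₂ → (x₁ + t * y₁) * a + (x₂ + t * y₂) * b
                                ≡ (x₁ * a + x₂ * b) + t * (y₁ * a + y₂ * b)
    lemma = solve-∀

  form-vanishes : ∀ β j → N ∣ β ℕ.* toℕ (g 0F j) → N ∣ β ℕ.* toℕ (g 1F j) →
                  ∀ x → n ∣ℤ + β * form j x
  form-vanishes β j N∣βa N∣βb (x₁ , x₂) =
    ∣-combination (lift N∣βa) (lift N∣βb) x₁ x₂
      (lemma (+ β) (+ toℕ (g 0F j)) (+ toℕ (g 1F j)) x₁ x₂)
    where
    lift : ∀ {a} → N ∣ β ℕ.* a → n ∣ℤ + β * + a
    lift {a} N∣βa = subst (n ∣ℤ_) (ℤₚ.pos-* β a) (ℤ∣.∣ᵤ⇒∣ N∣βa)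
    lemma : ∀ β a b x₁ x₂ → x₁ * (β * a) + x₂ * (β * b) ≡ β * (x₁ * a + x₂ * b)
    lemma = solve-∀

  gcd-annihilates : ∀ β j → N ∣ β ℕ.* columnGcd g j → ∀ x → n ∣ℤ + β * form j x
  gcd-annihilates β j N∣βd = form-vanishes β j
    (ℕ.∣-trans N∣βd (ℕ.*-monoʳ-∣ β (ℕ.∣-trans d∣ (ℕ.gcd[m,n]∣m a b))))
    (ℕ.∣-trans N∣βd (ℕ.*-monoʳ-∣ β (ℕ.∣-trans d∣ (ℕ.gcd[m,n]∣n a b))))
    where
    a b : ℕ
    a = toℕ (g 0F j)
    b = toℕ (g 1F j)
    d∣ : columnGcd g j ∣ ℕ.gcd a b
    d∣ = ℕ.gcd[m,n]∣m (ℕ.gcd a b) N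

  vanishing⊎nonzero : ∀ β j → N ∣ β ℕ.* columnGcd g j ⊎ Nonzero (λ x → + β * form j x)
  vanishing⊎nonzero β j with N ℕ.∣? β ℕ.* a | N ℕ.∣? β ℕ.* b
    where
    a b : ℕ
    a = toℕ (g 0F j)
    b = toℕ (g 1F j)
  ... | no N∤βa | _ = inj₂ ((1ℤ , 0ℤ) , λ n∣ → N∤βa
    (ℤ∣.∣⇒∣ᵤ (subst (n ∣ℤ_)
      (trans (lemma (+ β) (+ toℕ (g 0F j)) (+ toℕ (g 1F j))) (sym (ℤₚ.pos-* β _))) n∣)))
    where
    lemma : ∀ β a b → β * (1ℤ * a + 0ℤ * b) ≡ β * a
    lemma = solve-∀
  ... | yes _ | no N∤βb = inj₂ ((0ℤ , 1ℤ) , λ n∣ → N∤βb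
    (ℤ∣.∣⇒∣ᵤ (subst (n ∣ℤ_)
      (trans (lemma (+ β) (+ toℕ (g 0F j)) (+ toℕ (g 1F j))) (sym (ℤₚ.pos-* β _))) n∣)))
    where
    lemma : ∀ β a b → β * (0ℤ * a + 1ℤ * b) ≡ β * b
    lemma = solve-∀
  ... | yes N∣βa | yes N∣βb = inj₁ $ subst (N ∣_) (sym eq) $
    ℕ.gcd-greatest (ℕ.gcd-greatest N∣βa N∣βb) (ℕ.∣n⇒∣m*n β ℕ.∣-refl)
    where
    a b : ℕ
    a = toℕ (g 0F j)
    b = toℕ (g 1F j)
    eq : β ℕ.* columnGcd g j ≡ ℕ.gcd (ℕ.gcd (β ℕ.* a) (β ℕ.* b)) (β ℕ.* N)
    eq = trans (ℕ.c*gcd[m,n]≡gcd[cm,cn] β (ℕ.gcd a b) N)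
               (cong (λ d → ℕ.gcd d (β ℕ.* N)) (ℕ.c*gcd[m,n]≡gcd[cm,cn] β a b))

  mod-congruent : ∀ k → n ∣ℤ + k - + toℕ (k ℕ.mod N)
  mod-congruent k = ℤ∣.divides (+ (k ℕ./ N)) $ begin
    + k - + toℕ (k ℕ.mod N)              ≡⟨ cong (λ z → + k - + z) (toℕ-fromℕ< (ℕ.m%n<n k N)) ⟩
    + k - + r                            ≡⟨ cong (λ z → + z - + r) (ℕ.m≡m%n+[m/n]*n k N) ⟩
    + (r ℕ.+ k ℕ./ N ℕ.* N) - + r        ≡⟨ cong (_- + r) (ℤₚ.pos-+ r _) ⟩
    + r + + (k ℕ./ N ℕ.* N) - + r        ≡⟨ lemma (+ r) _ ⟩
    + (k ℕ./ N ℕ.* N)                    ≡⟨ ℤₚ.pos-* (k ℕ./ N) N ⟩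
    + (k ℕ./ N) * n                      ∎
    where
    open ≡-Reasoning
    r : ℕ
    r = k ℕ.% N
    lemma : ∀ r z → r + z - r ≡ z
    lemma = solve-∀

  residue : ℤ → Fin N
  residue z = fromℕ< (n%ℕd<d z N)

  residue-congruent : ∀ z → n ∣ℤ z - + toℕ (residue z)
  residue-congruent z = ℤ∣.divides (z /ℕ N) $
    trans (cong₂ (λ a b → a - + b) (a≡a%ℕn+[a/ℕn]*n z N) (toℕ-fromℕ< _)) (lemma (+ (z %ℕ N)) _)
    where
    lemma : ∀ r z → r + z - r ≡ z
    lemma = solve-∀

  combination-congruent : ∀ (c : Fin 2 → Fin N) j →
    n ∣ℤ form j (+ toℕ (c 0F) , + toℕ (c 1F)) - + toℕ (combination c g j)
  combination-congruent c j = subst (λ z → n ∣ℤ z - + toℕ (combination c g j)) eq (mod-congruent _)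
    where
    eq : + (toℕ (c 0F) ℕ.* toℕ (g 0F j) ℕ.+ (toℕ (c 1F) ℕ.* toℕ (g 1F j) ℕ.+ 0))
       ≡ form j (+ toℕ (c 0F) , + toℕ (c 1F))
    eq = trans (cong (λ k → + (toℕ (c 0F) ℕ.* toℕ (g 0F j) ℕ.+ k)) (ℕ.+-identityʳ _)) $
         trans (ℤₚ.pos-+ (toℕ (c 0F) ℕ.* toℕ (g 0F j)) _) $
         cong₂ _+_ (ℤₚ.pos-* (toℕ (c 0F)) _) (ℤₚ.pos-* (toℕ (c 1F)) _)

  coefficients : Point → Fin 2 → Fin N
  coefficients (x₁ , x₂) 0F = residue x₁
  coefficients (x₁ , x₂) 1F = residue x₂

  word : Point → Word N m
  word x = combination (coefficients x) g

  word∈code : ∀ x → word x ∈ generatedBy g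
  word∈code x = coefficients x , λ _ → refl

  word-congruent : ∀ x j → n ∣ℤ form j x - + toℕ (word x j)
  word-congruent x@(x₁ , x₂) j = subst (n ∣ℤ_) (lemma (form j x) (form j x′) _) $
    ℤ∣.∣m∣n⇒∣m+n congruent (combination-congruent (coefficients x) j)
    where
    x′ : Point
    x′ = + toℕ (residue x₁) , + toℕ (residue x₂)
    lemma : ∀ u v w → u - v + (v - w) ≡ u - w
    lemma = solve-∀
    congruent : n ∣ℤ form j x - form j x′
    congruent = ∣-combination (residue-congruent x₁) (residue-congruent x₂)
                              (+ toℕ (g 0F j)) (+ toℕ (g 1F j))
                              (eq (+ toℕ (g 0F j)) (+ toℕ (g 1F j)) x₁ x₂ (proj₁ x′) (proj₂ x′))
      where
      eq : ∀ a b x₁ x₂ y₁ y₂ → a * (x₁ - y₁) + b * (x₂ - y₂) ≡ x₁ * a + x₂ * b - (y₁ * a + y₂ * b)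
      eq = solve-∀

  thin⇒covered : Thin (generatedBy g) → ∀ x → ∃[ j ] n ∣ℤ form j x
  thin⇒covered (_ , ¬full) x with any? (λ j → toℕ (word x j) ℕ.≟ 0)
  ... | yes (j , w≡0) = j ,
    subst (n ∣ℤ_) (trans (cong (λ k → form j x - + k) w≡0) (ℤₚ.+-identityʳ _)) (word-congruent x j)
  ... | no ¬∃ = contradiction (word x , word∈code x , curry ¬∃) ¬full

  annihilates-code : ∀ β → (∀ j → N ∣ β ℕ.* columnGcd g j) →
                     Admissible (generatedBy g) → N ∣ β
  annihilates-code β N∣βd (_ , gcd≡1) = annihilated-coprime N β gcd≡1 annihilates
    where
    lemma : ∀ β f w → 1ℤ * (β * f) + - β * (f - w) ≡ β * w
    lemma = solve-∀
    annihilates : ∀ {x} → x ∈ ModulusOrEntry (generatedBy g) → N ∣ β ℕ.* x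
    annihilates (inj₁ refl) = ℕ.∣n⇒∣m*n β ℕ.∣-refl
    annihilates (inj₂ (w , (c , w≡) , j , refl)) =
      ℤ∣.∣⇒∣ᵤ $ subst (n ∣ℤ_) (sym (ℤₚ.pos-* β _)) $
      subst (λ v → n ∣ℤ + β * + toℕ v) (sym (w≡ j)) $
      ∣-combination (gcd-annihilates β j (N∣βd j) x) (combination-congruent c j) 1ℤ (- + β)
        (lemma (+ β) (form j x) _)
      where
      x : Point
      x = + toℕ (c 0F) , + toℕ (c 1F)

module _ {i j : Fin 5} (i≢j : i ≢ j) where

  others : Fin 3 → Fin 5
  others k = punchIn i (punchIn (punchOut i≢j) k)

  others≢i : ∀ k → others k ≢ i
  others≢i k = punchInᵢ≢i i _

  others≢j : ∀ k → others k ≢ j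
  others≢j k eq = punchInᵢ≢i (punchOut i≢j) k
    (punchIn-injective i _ _ (trans eq (sym (punchIn-punchOut i≢j))))

  others-complete : ∀ l → l ≡ i ⊎ l ≡ j ⊎ ∃[ k ] l ≡ others k
  others-complete l with i ≟ l
  ... | yes i≡l = inj₁ (sym i≡l)
  ... | no i≢l with punchOut i≢j ≟ punchOut i≢l
  ...   | yes eq = inj₂ (inj₁ (trans (sym (punchIn-punchOut i≢l))
                                     (trans (cong (punchIn i) (sym eq)) (punchIn-punchOut i≢j))))
  ...   | no neq = inj₂ (inj₂ (punchOut neq ,
                     sym (trans (cong (punchIn i) (punchIn-punchOut neq)) (punchIn-punchOut i≢l))))

  sum-split : ∀ (t : Fin 5 → ℕ) →
    sum ℕ.+-0-monoid t ≡
    t i ℕ.+ (t j ℕ.+ (t (others 0F) ℕ.+ (t (others 1F) ℕ.+ (t (others 2F) ℕ.+ 0))))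
  sum-split t = begin
    sum ℕ.+-0-monoid t
      ≡⟨ sum-remove ℕ.+-0-commutativeMonoid {i = i} t ⟩
    t i ℕ.+ sum ℕ.+-0-monoid (removeAt t i)
      ≡⟨ cong (t i ℕ.+_) (sum-remove ℕ.+-0-commutativeMonoid {i = punchOut i≢j} (removeAt t i)) ⟩
    t i ℕ.+ (t (punchIn i (punchOut i≢j)) ℕ.+ rest)
      ≡⟨ cong (λ k → t i ℕ.+ (t k ℕ.+ rest)) (punchIn-punchOut i≢j) ⟩
    t i ℕ.+ (t j ℕ.+ rest)
      ∎
    where
    open ≡-Reasoning
    rest : ℕ
    rest = t (others 0F) ℕ.+ (t (others 1F) ℕ.+ (t (others 2F) ℕ.+ 0))

module Configuration (N : ℕ) .{{_ : NonZero N}} (9≤N : 9 ≤ N)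
  (α : ℕ) {{α≢0 : NonZero α}} (α≤4 : α ≤ 4)
  (M : ℕ) (N≡Mα : N ≡ M ℕ.* α) (g : Matrix N 2 5)
  (admissible : Admissible (generatedBy g)) (thin : Thin (generatedBy g))
  {i j : Fin 5} (i≢j : i ≢ j) (gcdᵢ≡M : columnGcd g i ≡ M) (gcdⱼ≡M : columnGcd g j ≡ M)
  (gcd<M : ∀ k → k ≢ i → k ≢ j → columnGcd g k < M) where

  open Columns N g

  p q : Point → ℤ
  p = form i
  q = form j

  r : Fin 3 → Point → ℤ
  r k = form (others i≢j k)

  instance
    columnGcd≢0 : ∀ {l} → NonZero (columnGcd g l)
    columnGcd≢0 {l} = ℕ.≢-nonZero (ℕ.gcd[m,n]≢0 (ℕ.gcd (toℕ (g 0F l)) (toℕ (g 1F l))) N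
                                    (inj₂ (ℕ.≢-nonZero⁻¹ N)))

  βgcd<N⇒nonzero : ∀ β l .{{_ : NonZero β}} → β ℕ.* columnGcd g l < N →
                   Nonzero (λ x → + β * form l x)
  βgcd<N⇒nonzero β l βd<N with vanishing⊎nonzero β l
  ... | inj₁ N∣βd = contradiction N∣βd (ℕ.>⇒∤ {{ℕ.m*n≢0 β (columnGcd g l)}} βd<N)
  ... | inj₂ nonzero = nonzero

  N≡αM : N ≡ α ℕ.* M
  N≡αM = trans N≡Mα (ℕ.*-comm M α)

  β<α⇒nonzero : ∀ β .{{_ : NonZero β}} → β < α → ∀ {l} → columnGcd g l ≡ M →
                Nonzero (λ x → + β * form l x)
  β<α⇒nonzero β β<α {l} refl = βgcd<N⇒nonzero β l
    (subst (β ℕ.* M <_) (sym N≡αM) (ℕ.*-monoˡ-< M β<α))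

  gcd≡M⇒N∣αgcd : ∀ {l} → columnGcd g l ≡ M → N ∣ α ℕ.* columnGcd g l
  gcd≡M⇒N∣αgcd refl = ℕ.∣-reflexive N≡αM

  αr≢0 : ∀ k → Nonzero (λ x → + α * r k x)
  αr≢0 k = βgcd<N⇒nonzero α (others i≢j k) $
    subst (α ℕ.* columnGcd g (others i≢j k) <_) (sym N≡αM) $
    ℕ.*-monoʳ-< α (gcd<M _ (others≢i i≢j k) (others≢j i≢j k))

  multiple-vanishes : ∀ {l} c → columnGcd g l ≡ M → N ∣ c ℕ.* α ℕ.* columnGcd g l
  multiple-vanishes {l} c gcd≡M = subst (N ∣_) (sym (ℕ.*-assoc c α (columnGcd g l)))
    (ℕ.∣n⇒∣m*n c (gcd≡M⇒N∣αgcd gcd≡M))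

  small-multiple-annihilates-not : ∀ c .{{_ : NonZero c}} → c ℕ.* α ≤ 8 →
                                   ¬ (∀ k → N ∣ c ℕ.* α ℕ.* columnGcd g (others i≢j k))
  small-multiple-annihilates-not c cα≤8 vanish =
    ℕ.>⇒∤ {{ℕ.m*n≢0 c α}} (ℕ.≤-trans (ℕ.s≤s cα≤8) 9≤N) $
    annihilates-code (c ℕ.* α) everywhere admissible
    where
    everywhere : ∀ l → N ∣ c ℕ.* α ℕ.* columnGcd g l
    everywhere l with others-complete i≢j l
    ... | inj₁ refl              = multiple-vanishes c gcdᵢ≡M
    ... | inj₂ (inj₁ refl)       = multiple-vanishes c gcdⱼ≡M
    ... | inj₂ (inj₂ (k , refl)) = vanish k

  2αr≢0 : ∃[ k ] Nonzero (λ x → + 2 * (+ α * r k x))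
  2αr≢0 with ¬∀⟶∃¬ 3 _ (λ k → N ℕ.∣? 2 ℕ.* α ℕ.* columnGcd g (others i≢j k))
                   (small-multiple-annihilates-not 2 (ℕ.*-monoʳ-≤ 2 α≤4))
  ... | k , N∤ with vanishing⊎nonzero (2 ℕ.* α) (others i≢j k)
  ...   | inj₁ N∣ = contradiction N∣ N∤
  ...   | inj₂ (x , ≢0) = k , x , ≢0 ∘ subst (n ∣ℤ_)
    (trans (sym (ℤₚ.*-assoc (+ 2) (+ α) (r k x))) (cong (_* r k x) (sym (ℤₚ.pos-* 2 α))))

  ∑r≡0 : ∀ x → n ∣ℤ + α * r 0F x + + α * r 1F x + + α * r 2F x
  ∑r≡0 x = ∣-combination
    (ℤ∣.∣m∣n⇒∣m+n (ℤ∣.∣m∣n⇒∣m+n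
      (∣-combination ∑w≡0 (word-congruent x i) (+ α) (+ α) refl)
      (∣-combination (word-congruent x j) (word-congruent x (o 0F)) (+ α) (+ α) refl))
      (∣-combination (word-congruent x (o 1F)) (word-congruent x (o 2F)) (+ α) (+ α) refl))
    (ℤ∣.∣m∣n⇒∣m+n (gcd-annihilates α i (gcd≡M⇒N∣αgcd gcdᵢ≡M) x)
                  (gcd-annihilates α j (gcd≡M⇒N∣αgcd gcdⱼ≡M) x))
    1ℤ (- 1ℤ) (lemma (+ α) (p x) (q x) (r 0F x) (r 1F x) (r 2F x)
                    (w i) (w j) (w (o 0F)) (w (o 1F)) (w (o 2F)))
    where
    o : Fin 3 → Fin 5
    o = others i≢j
    w : Fin 5 → ℤ
    w l = + toℕ (word x l)
    lemma : ∀ α p q r₀ r₁ r₂ u v w₀ w₁ w₂ →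
      1ℤ * (α * (u + (v + (w₀ + (w₁ + (w₂ + 0ℤ))))) + α * (p - u)
            + (α * (q - v) + α * (r₀ - w₀)) + (α * (r₁ - w₁) + α * (r₂ - w₂)))
      + - 1ℤ * (α * p + α * q) ≡ α * r₀ + α * r₁ + α * r₂
    lemma = solve-∀
    ∑w≡0 : n ∣ℤ w i + (w j + (w (o 0F) + (w (o 1F) + (w (o 2F) + 0ℤ))))
    ∑w≡0 = ℤ∣.∣ᵤ⇒∣ (subst (N ∣_) (sum-split i≢j (λ l → toℕ (word x l)))
                     (proj₁ thin (word x) (word∈code x)))

  covered : ∀ x → n ∣ℤ p x ⊎ n ∣ℤ q x ⊎ ∃[ k ] n ∣ℤ r k x
  covered x with thin⇒covered thin x
  ... | l , l≡0 with others-complete i≢j l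
  ...   | inj₁ refl              = inj₁ l≡0
  ...   | inj₂ (inj₁ refl)       = inj₂ (inj₁ l≡0)
  ...   | inj₂ (inj₂ (k , refl)) = inj₂ (inj₂ (k , l≡0))

  αr-avoided : ∃[ y ] (∀ k → n ∤ℤ + α * r k y)
  αr-avoided = avoid-family (λ k → scale (+ α) (form-linear (others i≢j k))) αr≢0 2αr≢0

  open Covering {α = + α} {p} {q} {r}
    (form-linear i) (form-linear j) (λ k → form-linear (others i≢j k))
    (gcd-annihilates α i (gcd≡M⇒N∣αgcd gcdᵢ≡M)) (gcd-annihilates α j (gcd≡M⇒N∣αgcd gcdⱼ≡M))
    ∑r≡0 covered (proj₁ αr-avoided) (proj₂ αr-avoided) public

  gcd≡M⇒form≢0 : 1 < α → ∀ {l} → columnGcd g l ≡ M → Nonzero (form l)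
  gcd≡M⇒form≢0 1<α gcd≡M with β<α⇒nonzero 1 1<α gcd≡M
  ... | x , ≢0 = x , ≢0 ∘ ℤ∣.∣n⇒∣m*n 1ℤ

  good-point : 1 < α → ∃ Good
  good-point 1<α = avoid-two (form-linear i) (form-linear j)
    (gcd≡M⇒form≢0 1<α gcdᵢ≡M) (gcd≡M⇒form≢0 1<α gcdⱼ≡M)

  α-annihilates-not : 2 < α → ¬ (∀ x → Good x → ∀ k → n ∣ℤ + α * r k x)
  α-annihilates-not 2<α = α-cannot-annihilate (β<α⇒nonzero 2 2<α gcdᵢ≡M)
    (gcd≡M⇒form≢0 (ℕ.<-trans (ℕ.n<1+n 1) 2<α) gcdⱼ≡M)

  good-annihilator-not-small : 1 < α → ∀ s .{{_ : NonZero s}} → s ℕ.* α ≤ 8 →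
                               ¬ (∀ x → Good x → ∀ k → n ∣ℤ + s * r k x)
  good-annihilator-not-small 1<α s sα≤8 sr≡0 =
    small-multiple-annihilates-not s sα≤8 λ k →
      vanishes k (vanishing⊎nonzero (s ℕ.* α) (others i≢j k))
    where
    vanishes : ∀ k → N ∣ s ℕ.* α ℕ.* columnGcd g (others i≢j k) ⊎
                     Nonzero (λ x → + (s ℕ.* α) * r k x) →
               N ∣ s ℕ.* α ℕ.* columnGcd g (others i≢j k)
    vanishes k (inj₁ N∣) = N∣
    vanishes k (inj₂ (z , ≢0)) = contradiction
      (subst (λ c → n ∣ℤ c * r k z) (sym (ℤₚ.pos-* s α))
        (annihilator-on-good⇒everywhere (+ s) (good-point 1<α) sr≡0 k z)) ≢0

lemma3p7 : ∀ (N : ℕ) .{{_ : NonZero N}} → 9 ≤ N →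
    ∀ (α : ℕ) → α ≡ 2 ⊎ α ≡ 3 ⊎ α ≡ 4 → (α∣N : α ∣ N) →
    let Mα = quotient α∣N in
    (g : Matrix N 2 5) → Admissible (generatedBy g) →
    (∃[ i ] ∃[ j ] (i ≢ j × columnGcd g i ≡ Mα × columnGcd g j ≡ Mα ×
    (∀ k → k ≢ i → k ≢ j → columnGcd g k < Mα))) →
    ¬ (Thin (generatedBy g) × ¬ Degenerate (generatedBy g))
lemma3p7 N 9≤N 2 (inj₁ refl) (ℕ.divides M N≡M2) g adm (i , j , i≢j , dᵢ , dⱼ , dₖ) (thin , _) =
  C.good-annihilator-not-small (ℕ.n<1+n 1) 4 ℕ.≤-refl λ x good →
    [ (λ 3r≡0 → contradiction 3r≡0 (C.unit-cannot-annihilate (+ 3) 1ℤ (- 1ℤ) refl x good)) , id ]′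
      (C.3-or-4-annihilates x good)
  where
  module C = Configuration N 9≤N 2 (ℕ.m≤m+n 2 2) M N≡M2 g adm thin i≢j dᵢ dⱼ dₖ
lemma3p7 N 9≤N 3 (inj₂ (inj₁ refl)) (ℕ.divides M N≡M3) g adm (i , j , i≢j , dᵢ , dⱼ , dₖ) (thin , _) =
  C.α-annihilates-not (ℕ.n<1+n 2) λ x good →
    [ id , (λ 4r≡0 → contradiction 4r≡0 (C.unit-cannot-annihilate (+ 4) 1ℤ (- 1ℤ) refl x good)) ]′
      (C.3-or-4-annihilates x good)
  where
  module C = Configuration N 9≤N 3 (ℕ.m≤m+n 3 1) M N≡M3 g adm thin i≢j dᵢ dⱼ dₖ
lemma3p7 N 9≤N 4 (inj₂ (inj₂ refl)) (ℕ.divides M N≡M4) g adm (i , j , i≢j , dᵢ , dⱼ , dₖ) (thin , _) =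
  C.α-annihilates-not (ℕ.m≤m+n 3 1) λ x good →
    [ (λ 3r≡0 → contradiction 3r≡0 (C.unit-cannot-annihilate (+ 3) (- 1ℤ) 1ℤ refl x good)) , id ]′
      (C.3-or-4-annihilates x good)
  where
  module C = Configuration N 9≤N 4 ℕ.≤-refl M N≡M4 g adm thin i≢j dᵢ dⱼ dₖ
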